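{- Let $n,m,\ell$ be positive integers. Then $$\sum_{j=0}^{n-m-1}\binom{m-\ell+2j}{j}\,\mathcal Y_n\big(2^{\{\ell-j\}},1^{\{m-\ell+2j\}}\big)=\frac{1}{(m+1)(\ell+1)}\binom{n-1}{m}\binom{n-1}{\ell}.$$
   Context: Let $\zeta_n=e^{2\pi\sqrt{ -1}/n}$. For positive integers $s_1,\dots,s_m$, define $\mathfrak Z_n(s_1,\dots,s_m):=\sum_{1\le i_1<\cdots<i_m\le n-1}\prod_{k=1}^{m}(1-\zeta_n^{i_k})^{ -s_k}$ (equal to $0$ if $m>n-1$). Define $\mathcal Y_n(s_1,\dots,s_m):=\sum_{\sigma}\mathfrak Z_n(\sigma)$, where $\sigma$ runs over all distinct rearrangements of $(s_1,\dots,s_m)$. Notation: $a^{\{k\}}$ denotes the block $a,\dots,a$ of length $k$; any $\mathcal Y_n$ term in which some block has negative length is interpreted as $0$, and a sum whose upper limit is below its lower limit is $0$. Binomial coefficients $\binom{a}{b}$ are $0$ when $b<0$ or $b>a\ge0$. -}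

module Defs where

open import Level using (Level; _⊔_)
open import Algebra.Apartness.Bundles using (HeytingCommutativeRing; HeytingField)
open import Algebra.Bundles using (CommutativeRing; Semiring)
import Algebra.Definitions.RawSemiring as RawSemiringDefinitions
open import Data.Fin.Base using (Fin; toℕ)
open import Data.Fin.Properties using (toℕ<n)
open import Data.Integer.Base as ℤ using (ℤ; +_; -[1+_])
open import Data.List.Base using (List; []; _∷_; _++_; map; foldr; concatMap; zipWith; length; replicate; allFin; deduplicate)
open import Data.List.Properties using (≡-dec)
open import Data.Nat.Base as ℕ using (ℕ; zero; suc; NonZero)
open import Data.Nat.Combinatorics using (_C_)
import Data.Nat.Properties as ℕ
open import Data.Product.Base using (proj₁)

private variable
  a : Level
  A : Set a

-- The subsequences of length k of a list, taken by position.
choose : ℕ → List A → List (List A)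
choose zero    xs       = [] ∷ []
choose (suc k) []       = []
choose (suc k) (x ∷ xs) = map (x ∷_) (choose k xs) ++ choose (suc k) xs

insertions : A → List A → List (List A)
insertions x []       = (x ∷ []) ∷ []
insertions x (y ∷ ys) = (x ∷ y ∷ ys) ∷ map (y ∷_) (insertions x ys)

-- With multiplicity: a list of length m has m ! entries here.
permutations : List A → List (List A)
permutations []       = [] ∷ []
permutations (x ∷ xs) = concatMap (insertions x) (permutations xs)

distinctRearrangements : List ℕ → List (List ℕ)
distinctRearrangements s = deduplicate (≡-dec ℕ._≟_) (permutations s)

-- Upper index in ℤ.  A negative upper index uses the polynomial extension
-- binom(-(r+1), k) = (-1)^k binom(r+k, k).
binomial : ℤ → ℕ → ℤ
binomial (+ r)    k = + (r C k)
binomial -[1+ r ] k = (ℤ.-1ℤ ℤ.^ k) ℤ.* + ((r ℕ.+ k) C k)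

module RootOfUnitySums {c ℓ₁ ℓ₂ : Level} (F : HeytingField c ℓ₁ ℓ₂) where

  open HeytingField F
  open RawSemiringDefinitions (Semiring.rawSemiring (CommutativeRing.semiring (HeytingCommutativeRing.commutativeRing heytingCommutativeRing))) using (_×_; _^_)

  fromℕ : ℕ → Carrier
  fromℕ k = k × 1#

  fromℤ : ℤ → Carrier
  fromℤ (+ k)    = fromℕ k
  fromℤ -[1+ k ] = - fromℕ (suc k)

  sumOver : List A → (A → Carrier) → Carrier
  sumOver xs f = foldr _+_ 0# (map f xs)

  syntax sumOver xs (λ x → e) = ∑[ x ∈ xs ] e

  product : List Carrier → Carrier
  product = foldr _*_ 1#

  -- (x - y)⁻¹
  inverseOfDifference : ∀ {x y} → x # y → Carrier
  inverseOfDifference x#y = proj₁ (#⇒invertible x#y)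

  CharacteristicZero : Set ℓ₂
  CharacteristicZero = ∀ k .{{_ : NonZero k}} → fromℕ k # 0#

  -- 1 / k, as the inverse of k - 0.
  reciprocal : CharacteristicZero → ∀ k .{{_ : NonZero k}} → Carrier
  reciprocal char0 k = inverseOfDifference (char0 k)

  record IsPrimitiveRoot (n : ℕ) (ζ : Carrier) : Set (ℓ₁ ⊔ ℓ₂) where
    field
      ζ^n≈1 : ζ ^ n ≈ 1#
      1#ζ^i : ∀ i → 0 ℕ.< i → i ℕ.< n → 1# # (ζ ^ i)

  module _ (n : ℕ) .{{_ : NonZero n}} {ζ : Carrier} (prim : IsPrimitiveRoot n ζ) where

    open IsPrimitiveRoot prim

    -- (1 - ζ ^ i)⁻¹ for 1 ≤ i ≤ n - 1, where i is encoded as suc (toℕ j).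
    [1-ζ^_]⁻¹ : Fin (n ℕ.∸ 1) → Carrier
    [1-ζ^ j ]⁻¹ = inverseOfDifference
      (1#ζ^i (suc (toℕ j)) (ℕ.s≤s ℕ.z≤n) (ℕ.m≤pred[n]⇒suc[m]≤n (toℕ<n j)))

    -- allFin is strictly increasing, so choose enumerates exactly the
    -- tuples 1 ≤ i₁ < ⋯ < iₘ ≤ n - 1.
    ℨ : List ℕ → Carrier
    ℨ s = ∑[ is ∈ choose (length s) (allFin (n ℕ.∸ 1)) ]
            product (zipWith (λ i sₖ → [1-ζ^ i ]⁻¹ ^ sₖ) is s)

    𝒴 : List ℕ → Carrier
    𝒴 s = ∑[ σ ∈ distinctRearrangements s ] ℨ σ

    -- 𝒴ₙ(2^{a}, 1^{b}), which is 0 when a block length is negative.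
    𝒴[2^_,1^_] : ℤ → ℤ → Carrier
    𝒴[2^ + a ,1^ + b ]           = 𝒴 (replicate a 2 ++ replicate b 1)
    𝒴[2^ + _ ,1^ -[1+ _ ] ]      = 0#
    𝒴[2^ -[1+ _ ] ,1^ _ ]        = 0#

{-# OPTIONS --safe #-}

-- Put xᵢ = (1 - ζⁱ)⁻¹ for 0 < i < n.  Summing ℨₙ over the distinct rearrangements
-- of (2^{a}, 1^{b}) gives the monomial symmetric polynomial m_{(2^a, 1^b)} of the
-- xᵢ, and a product of two elementary symmetric polynomials expands as
--   eₘ eₗ = ∑ⱼ binom(m - ℓ + 2j, j) m_{(2^{ℓ-j}, 1^{m-ℓ+2j})},
-- so the left-hand side is eₘ eₗ.  The polynomials n ∏ᵢ (1 + xᵢ s) and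
-- ((1 + s)ⁿ - 1) / s have degree < n and agree at the n points s = ζⁱ - 1 with
-- 0 ≤ i < n (at s = 0 both are n, elsewhere both vanish), whence
-- n eₖ = binom(n, k + 1), that is, (k + 1) eₖ = binom(n - 1, k).
module Submission where

open import Defs
open import Algebra.Apartness.Bundles using (HeytingCommutativeRing; HeytingField)
open import Algebra.Bundles using (CommutativeRing; CommutativeSemiring)
open import Data.Empty using (⊥)
open import Data.Fin.Base using (toℕ; fromℕ<)
open import Data.Fin.Properties using (toℕ<n; toℕ-fromℕ<)
open import Data.Integer.Base as ℤ using (+_)
open import Data.Integer.Tactic.RingSolver using () renaming (solve-∀ to ℤ-solve-∀)
open import Data.List.Base using (List; []; _∷_; _++_; map; length; replicate; upTo; allFin; zipWith)
open import Data.List.Membership.Propositional using (_∈_; find; lose)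
open import Data.List.Membership.Propositional.Properties
  using (∈-map⁺; ∈-map⁻; ∈-++⁺ˡ; ∈-++⁺ʳ; ∈-++⁻; ∈-concatMap⁺; ∈-concatMap⁻; ∈-allFin; deduplicate-∈⇔)
open import Data.List.Membership.Propositional.Properties.WithK using (unique∧set⇒bag)
open import Data.List.Properties using (≡-dec; ∷-injectiveʳ; upTo-∷ʳ; length-map; length-replicate; length-tabulate)
open import Data.List.Relation.Binary.BagAndSetEquality using (∼bag⇒↭)
open import Data.List.Relation.Binary.Permutation.Propositional as ↭ using (_↭_)
open import Data.List.Relation.Unary.All using ([])
open import Data.List.Relation.Unary.AllPairs using ([]; _∷_)
open import Data.List.Relation.Unary.Any using (here; there)
open import Data.List.Relation.Unary.Unique.Propositional using (Unique)
import Data.List.Relation.Unary.Unique.Propositional.Properties as Unique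
open import Data.Nat.Base as ℕ using (ℕ; zero; suc; NonZero; s≤s; z≤n)
open import Data.Nat.Combinatorics using (_C_; nCn≡1; nC1≡n; nCk+nC[k+1]≡[n+1]C[k+1]; k>n⇒nCk≡0)
import Data.Nat.Properties as ℕ
import Data.Nat.Tactic.RingSolver as ℕ-Solver
open import Data.List.Relation.Unary.Unique.DecPropositional.Properties (≡-dec ℕ._≟_) using (deduplicate-!)
open import Data.Product.Base using (_,_; proj₁; proj₂; ∃-syntax; _×_)
open import Data.Sum.Base using (inj₁; inj₂)
open import Function.Base using (_∘_)
open import Function.Bundles using (Equivalence; mk⇔)
import Relation.Binary.PropositionalEquality.Core as ≡
open ≡ using (_≡_)
import Relation.Binary.PropositionalEquality.Properties as ≡

-- The product formula is proved by adjoining one variable x at a time: x is absent from a monomial,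
-- is squared (taken from both factors), or is simple and comes from one of the two factors; this
-- last choice is Pascal's rule for the coefficient. To keep indices natural, the term with p = ℓ -
-- j squares is written with m = p + r and ℓ = p + j, so that m - ℓ + 2j = r + j. Its natural range
-- is max(0, ℓ - m) ≤ j ≤ ℓ, while the given sum stops at n - m - 1. Equality in a Heyting field
-- need not be decidable, so the comparison of polynomials rests on cancelling invertible
-- differences of roots.

-- Distinct rearrangements of (2^{a}, 1^{b})

-- An enumeration by first letter, which sums can follow recursively; deduplicating a list of
-- permutations offers no such recursion.
twoOneWords : ℕ → ℕ → List (List ℕ)
twoOneWords zero    zero    = [] ∷ []
twoOneWords zero    (suc b) = map (1 ∷_) (twoOneWords zero b)
twoOneWords (suc a) zero    = map (2 ∷_) (twoOneWords a zero)
twoOneWords (suc a) (suc b) =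
  map (2 ∷_) (twoOneWords a (suc b)) ++ map (1 ∷_) (twoOneWords (suc a) b)

-- The common description through which membership in `permutations` and in `twoOneWords` is
-- compared.
data TwoOneWord : ℕ → ℕ → List ℕ → Set where
  []   : TwoOneWord 0 0 []
  two∷ : ∀ {a b σ} → TwoOneWord a b σ → TwoOneWord (suc a) b (2 ∷ σ)
  one∷ : ∀ {a b σ} → TwoOneWord a b σ → TwoOneWord a (suc b) (1 ∷ σ)

∈-twoOneWords⁺ : ∀ {a b σ} → TwoOneWord a b σ → σ ∈ twoOneWords a b
∈-twoOneWords⁺ []                        = here ≡.refl
∈-twoOneWords⁺ {b = zero}  (two∷ w)      = ∈-map⁺ _ (∈-twoOneWords⁺ w)
∈-twoOneWords⁺ {b = suc _} (two∷ w)      = ∈-++⁺ˡ (∈-map⁺ _ (∈-twoOneWords⁺ w))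
∈-twoOneWords⁺ {a = zero}  (one∷ w)      = ∈-map⁺ _ (∈-twoOneWords⁺ w)
∈-twoOneWords⁺ {a = suc a} {b = suc b} (one∷ w) =
  ∈-++⁺ʳ (map (2 ∷_) (twoOneWords a (suc b))) (∈-map⁺ _ (∈-twoOneWords⁺ w))

∈-twoOneWords⁻ : ∀ a b {σ} → σ ∈ twoOneWords a b → TwoOneWord a b σ
∈-twoOneWords⁻ zero    zero    (here ≡.refl) = []
∈-twoOneWords⁻ zero    (suc b) σ∈ with _ , τ∈ , ≡.refl ← ∈-map⁻ _ σ∈ = one∷ (∈-twoOneWords⁻ zero b τ∈)
∈-twoOneWords⁻ (suc a) zero    σ∈ with _ , τ∈ , ≡.refl ← ∈-map⁻ _ σ∈ = two∷ (∈-twoOneWords⁻ a zero τ∈)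
∈-twoOneWords⁻ (suc a) (suc b) σ∈ with ∈-++⁻ (map (2 ∷_) (twoOneWords a (suc b))) σ∈
... | inj₁ σ∈₂ with _ , τ∈ , ≡.refl ← ∈-map⁻ _ σ∈₂ = two∷ (∈-twoOneWords⁻ a (suc b) τ∈)
... | inj₂ σ∈₁ with _ , τ∈ , ≡.refl ← ∈-map⁻ _ σ∈₁ = one∷ (∈-twoOneWords⁻ (suc a) b τ∈)

twoOneWords-! : ∀ a b → Unique (twoOneWords a b)
twoOneWords-! zero    zero    = [] ∷ []
twoOneWords-! zero    (suc b) = Unique.map⁺ ∷-injectiveʳ (twoOneWords-! zero b)
twoOneWords-! (suc a) zero    = Unique.map⁺ ∷-injectiveʳ (twoOneWords-! a zero)
twoOneWords-! (suc a) (suc b) = Unique.++⁺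
  (Unique.map⁺ ∷-injectiveʳ (twoOneWords-! a (suc b)))
  (Unique.map⁺ ∷-injectiveʳ (twoOneWords-! (suc a) b))
  λ (σ∈₂ , σ∈₁) → 2∷≢1∷ (∈-map⁻ _ σ∈₂) (∈-map⁻ _ σ∈₁)
  where
  2∷≢1∷ : ∀ {σ : List ℕ} {A B : List ℕ → Set} →
          ∃[ τ ] A τ × σ ≡ 2 ∷ τ → ∃[ τ ] B τ × σ ≡ 1 ∷ τ → ⊥
  2∷≢1∷ (_ , _ , ≡.refl) (_ , _ , ())

insert-two : ∀ {a b ys σ} → TwoOneWord a b ys → σ ∈ insertions 2 ys → TwoOneWord (suc a) b σ
insert-two []       (here ≡.refl) = two∷ []
insert-two (two∷ w) (here ≡.refl) = two∷ (two∷ w)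
insert-two (one∷ w) (here ≡.refl) = two∷ (one∷ w)
insert-two (two∷ w) (there σ∈) with _ , τ∈ , ≡.refl ← ∈-map⁻ _ σ∈ = two∷ (insert-two w τ∈)
insert-two (one∷ w) (there σ∈) with _ , τ∈ , ≡.refl ← ∈-map⁻ _ σ∈ = one∷ (insert-two w τ∈)

insert-one : ∀ {a b ys σ} → TwoOneWord a b ys → σ ∈ insertions 1 ys → TwoOneWord a (suc b) σ
insert-one []       (here ≡.refl) = one∷ []
insert-one (two∷ w) (here ≡.refl) = one∷ (two∷ w)
insert-one (one∷ w) (here ≡.refl) = one∷ (one∷ w)
insert-one (two∷ w) (there σ∈) with _ , τ∈ , ≡.refl ← ∈-map⁻ _ σ∈ = two∷ (insert-one w τ∈)
insert-one (one∷ w) (there σ∈) with _ , τ∈ , ≡.refl ← ∈-map⁻ _ σ∈ = one∷ (insert-one w τ∈)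

∈-insertions-head : ∀ {x : ℕ} ys → x ∷ ys ∈ insertions x ys
∈-insertions-head []      = here ≡.refl
∈-insertions-head (_ ∷ _) = here ≡.refl

-- The leftmost 2 is removed. `permutations` inserts the 2s last, so a word with a 2 is traced back
-- to the insertion of a 2; once only 1s remain, the head serves as the inserted entry.
delete-two : ∀ {a b σ} → TwoOneWord (suc a) b σ → ∃[ ys ] TwoOneWord a b ys × σ ∈ insertions 2 ys
delete-two (two∷ w) = _ , w , ∈-insertions-head _
delete-two (one∷ w) with ys , w′ , σ∈ ← delete-two w = 1 ∷ ys , one∷ w′ , there (∈-map⁺ _ σ∈)

permutations⇒TwoOneWord : ∀ a b {σ} → σ ∈ permutations (replicate a 2 ++ replicate b 1) → TwoOneWord a b σ
permutations⇒TwoOneWord zero    zero    (here ≡.refl) = []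
permutations⇒TwoOneWord zero    (suc b) σ∈
  with _ , τ∈ , σ∈′ ← find (∈-concatMap⁻ _ {xs = permutations (replicate b 1)} σ∈)
  = insert-one (permutations⇒TwoOneWord zero b τ∈) σ∈′
permutations⇒TwoOneWord (suc a) b       σ∈
  with _ , τ∈ , σ∈′ ← find (∈-concatMap⁻ _ {xs = permutations (replicate a 2 ++ replicate b 1)} σ∈)
  = insert-two (permutations⇒TwoOneWord a b τ∈) σ∈′

TwoOneWord⇒permutations : ∀ a b {σ} → TwoOneWord a b σ → σ ∈ permutations (replicate a 2 ++ replicate b 1)
TwoOneWord⇒permutations zero    zero    []       = here ≡.refl
TwoOneWord⇒permutations zero    (suc b) (one∷ w) =
  ∈-concatMap⁺ (insertions 1) (lose (TwoOneWord⇒permutations zero b w) (∈-insertions-head _))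
TwoOneWord⇒permutations (suc a) b       w
  with _ , w′ , σ∈ ← delete-two w
  = ∈-concatMap⁺ (insertions 2) (lose (TwoOneWord⇒permutations a b w′) σ∈)

-- Two lists without duplicates and with the same members are equal as bags.
distinctRearrangements↭twoOneWords : ∀ a b →
  distinctRearrangements (replicate a 2 ++ replicate b 1) ↭ twoOneWords a b
distinctRearrangements↭twoOneWords a b = ∼bag⇒↭ (unique∧set⇒bag
  (deduplicate-! (permutations s))
  (twoOneWords-! a b)
  (mk⇔ (∈-twoOneWords⁺ ∘ permutations⇒TwoOneWord a b ∘ from)
       (to ∘ TwoOneWord⇒permutations a b ∘ ∈-twoOneWords⁻ a b)))
  where
  s = replicate a 2 ++ replicate b 1
  from : ∀ {σ} → σ ∈ distinctRearrangements s → σ ∈ permutations s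
  from = Equivalence.from (deduplicate-∈⇔ (≡-dec ℕ._≟_))
  to : ∀ {σ} → σ ∈ permutations s → σ ∈ distinctRearrangements s
  to = Equivalence.to (deduplicate-∈⇔ (≡-dec ℕ._≟_))

-- Product of two elementary symmetric polynomials

module SymmetricPolynomials {c ℓ} (R : CommutativeSemiring c ℓ) where

  open CommutativeSemiring R renaming (zero to *-zero)
  open import Algebra.Properties.Semiring.Mult semiring
    using (×-homo-+; ×-comm-*; ×-homo-1) renaming (_×_ to _·_)
  open import Algebra.Properties.CommutativeMonoid.Mult +-commutativeMonoid using (×-distrib-+)
  open import Algebra.Properties.Semiring.Exp semiring using (_^_)
  open import Algebra.Solver.Ring.NaturalCoefficients.Default R using (solve; _:+_; _:*_; _:=_; con)
  open import Relation.Binary.Reasoning.Setoid setoid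

  n×0≈0 : ∀ n → n · 0# ≈ 0#
  n×0≈0 zero    = refl
  n×0≈0 (suc n) = trans (+-identityˡ _) (n×0≈0 n)

  -- f (k - 1), with f (-1) = 0.
  pre : (ℕ → Carrier) → ℕ → Carrier
  pre f zero    = 0#
  pre f (suc k) = f k

  pre-*ʳ : ∀ {f g : ℕ → Carrier} {y} → (∀ k → f k ≈ g k * y) → ∀ k → pre f k ≈ pre g k * y
  pre-*ʳ f≈gy zero    = sym (zeroˡ _)
  pre-*ʳ f≈gy (suc k) = f≈gy k

  pre-*ˡ : ∀ {f g : ℕ → Carrier} {y} → (∀ k → f k ≈ y * g k) → ∀ k → pre f k ≈ y * pre g k
  pre-*ˡ f≈yg zero    = sym (zeroʳ _)
  pre-*ˡ f≈yg (suc k) = f≈yg k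

  ×-pre : ∀ n (f : ℕ → Carrier) k → n · pre f k ≈ pre (λ i → n · f i) k
  ×-pre n f zero    = n×0≈0 n
  ×-pre n f (suc k) = refl

  elementary : List Carrier → ℕ → Carrier
  elementary []       zero    = 1#
  elementary []       (suc k) = 0#
  elementary (x ∷ xs) k       = elementary xs k + x * pre (elementary xs) k

  -- The monomial symmetric polynomial of the partition (2^{a}, 1^{b}).
  monomial : List Carrier → ℕ → ℕ → Carrier
  monomial []       zero    zero    = 1#
  monomial []       zero    (suc b) = 0#
  monomial []       (suc a) b       = 0#
  monomial (x ∷ xs) a       b       =
    monomial xs a b + (x * x * pre (λ a′ → monomial xs a′ b) a + x * pre (monomial xs a) b)

  -- A monomial of type (2^{a}, 1^{b}) involves a + b distinct variables. This is what cuts the sum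
  -- off at j = n - m - 1.
  monomial-vanishes : ∀ xs a b → length xs ℕ.< a ℕ.+ b → monomial xs a b ≈ 0#
  monomial-vanishes []       zero    (suc b) _ = refl
  monomial-vanishes []       (suc a) b       _ = refl
  monomial-vanishes (x ∷ xs) a       b       l = begin
    monomial xs a b + (x * x * pre (λ a′ → monomial xs a′ b) a + x * pre (monomial xs a) b)
      ≈⟨ +-cong (monomial-vanishes xs a b (ℕ.<-trans (ℕ.n<1+n _) l))
                (+-cong (*-congˡ (two a l)) (*-congˡ (one b l))) ⟩
    0# + (x * x * 0# + x * 0#)
      ≈⟨ solve 1 (λ x → con 0 :+ (x :* x :* con 0 :+ x :* con 0) := con 0) refl x ⟩
    0# ∎
    where
    two : ∀ a → suc (length xs) ℕ.< a ℕ.+ b → pre (λ a′ → monomial xs a′ b) a ≈ 0#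
    two zero    _       = refl
    two (suc a) (s≤s l) = monomial-vanishes xs a b l
    one : ∀ b → suc (length xs) ℕ.< a ℕ.+ b → pre (monomial xs a) b ≈ 0#
    one zero    _       = refl
    one (suc b) l       = monomial-vanishes xs a b (ℕ.≤-pred (≡.subst (suc (length xs) ℕ.<_) (ℕ.+-suc a b) l))

  -- The contribution to e_{p+r} e_{p+j} of the monomials with p squares:
  -- choose which j of the r + j simple factors come from e_{p+j}.
  productTerm : List Carrier → ℕ → ℕ → ℕ → Carrier
  productTerm xs p r j = ((r ℕ.+ j) C j) · monomial xs p (r ℕ.+ j)

  -- A new simple variable comes either from the first factor, lowering r, or from the second,
  -- lowering j. On the boundary r = 0 or j = 0, `pre` deletes the impossible choice.
  pascal : ∀ xs p r j →
    ((r ℕ.+ j) C j) · pre (monomial xs p) (r ℕ.+ j)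
      ≈ pre (λ r′ → productTerm xs p r′ j) r + pre (productTerm xs p r) j
  pascal xs p zero    zero    = trans (n×0≈0 1) (sym (+-identityˡ 0#))
  pascal xs p zero    (suc j) = begin
    (suc j C suc j) · monomial xs p j ≡⟨ ≡.cong (_· monomial xs p j) (≡.trans (nCn≡1 (suc j)) (≡.sym (nCn≡1 j))) ⟩
    (j C j) · monomial xs p j         ≈⟨ +-identityˡ _ ⟨
    0# + (j C j) · monomial xs p j    ∎
  pascal xs p (suc r) zero    = sym (+-identityʳ _)
  pascal xs p (suc r) (suc j) = begin
    (suc (r ℕ.+ suc j) C suc j) · y
      ≡⟨ ≡.cong (_· y) (nCk+nC[k+1]≡[n+1]C[k+1] (r ℕ.+ suc j) j) ⟨
    ((r ℕ.+ suc j) C j ℕ.+ (r ℕ.+ suc j) C suc j) · y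
      ≈⟨ ×-homo-+ y ((r ℕ.+ suc j) C j) _ ⟩
    ((r ℕ.+ suc j) C j) · y + ((r ℕ.+ suc j) C suc j) · y
      ≈⟨ +-comm _ _ ⟩
    ((r ℕ.+ suc j) C suc j) · y + ((r ℕ.+ suc j) C j) · y
      ≡⟨ ≡.cong (λ b → ((r ℕ.+ suc j) C suc j) · y + (b C j) · monomial xs p b) (ℕ.+-suc r j) ⟩
    ((r ℕ.+ suc j) C suc j) · y + productTerm xs p (suc r) j ∎
    where y = monomial xs p (r ℕ.+ suc j)

  -- The summands are the monomials without x, with x squared (one x from each factor, so the
  -- coefficient is unchanged), and with x simple.
  productTerm-∷ : ∀ x xs p r j →
    productTerm (x ∷ xs) p r j ≈
      productTerm xs p r j +
      (x * x * pre (λ p′ → productTerm xs p′ r j) p +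
       x * (pre (λ r′ → productTerm xs p r′ j) r + pre (productTerm xs p r) j))
  productTerm-∷ x xs p r j = begin
    n · (monomial xs p b + (x * x * y₂ + x * y₁))
      ≈⟨ ×-distrib-+ _ _ n ⟩
    n · monomial xs p b + n · (x * x * y₂ + x * y₁)
      ≈⟨ +-congˡ (×-distrib-+ _ _ n) ⟩
    n · monomial xs p b + (n · (x * x * y₂) + n · (x * y₁))
      ≈⟨ +-congˡ (+-cong (sym (×-comm-* n _ _)) (sym (×-comm-* n _ _))) ⟩
    n · monomial xs p b + (x * x * (n · y₂) + x * (n · y₁))
      ≈⟨ +-congˡ (+-cong (*-congˡ (×-pre n _ p)) (*-congˡ (pascal xs p r j))) ⟩
    _ ∎
    where
    b = r ℕ.+ j
    n = b C j
    y₂ = pre (λ p′ → monomial xs p′ b) p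
    y₁ = pre (monomial xs p) b

  -- ∑_{q ≥ p} productTerm xs q (p + m - q) (p + k - q).
  productTail : List Carrier → ℕ → ℕ → ℕ → Carrier
  productTail xs p zero    k       = productTerm xs p zero k
  productTail xs p (suc m) zero    = productTerm xs p (suc m) zero
  productTail xs p (suc m) (suc k) = productTerm xs p (suc m) (suc k) + productTail xs (suc p) m k

  -- productTail xs (p - 1) m k, where for p = 0 the term q = -1 is 0.
  productTail⁻ : List Carrier → ℕ → ℕ → ℕ → Carrier
  productTail⁻ xs zero    m k = pre (λ m′ → pre (productTail xs 0 m′) k) m
  productTail⁻ xs (suc p) m k = productTail xs p m k

  productTail-k≡0 : ∀ xs p m → productTail xs p m zero ≡ productTerm xs p m zero
  productTail-k≡0 xs p zero    = ≡.refl
  productTail-k≡0 xs p (suc m) = ≡.refl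

  productTail-unfoldˡ : ∀ xs p m k →
    productTail xs p m (suc k) ≈ productTerm xs p m (suc k) + pre (λ m′ → productTail xs (suc p) m′ k) m
  productTail-unfoldˡ xs p zero    k = sym (+-identityʳ _)
  productTail-unfoldˡ xs p (suc m) k = refl

  productTail-unfoldʳ : ∀ xs p m k →
    productTail xs p (suc m) k ≈ productTerm xs p (suc m) k + pre (productTail xs (suc p) m) k
  productTail-unfoldʳ xs p m zero    = sym (+-identityʳ _)
  productTail-unfoldʳ xs p m (suc k) = refl

  productTail⁻-suc : ∀ xs p m k →
    productTail⁻ xs p (suc m) (suc k)
      ≈ pre (λ p′ → productTerm xs p′ (suc m) (suc k)) p + productTail xs p m k
  productTail⁻-suc xs zero    m k = sym (+-identityˡ _)
  productTail⁻-suc xs (suc p) m k = refl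

  productTail⁻-m≡0 : ∀ xs p k → productTail⁻ xs p zero k ≡ pre (λ p′ → productTerm xs p′ zero k) p
  productTail⁻-m≡0 xs zero    k = ≡.refl
  productTail⁻-m≡0 xs (suc p) k = ≡.refl

  productTail⁻-k≡0 : ∀ xs p m → productTail⁻ xs p m zero ≡ pre (λ p′ → productTerm xs p′ m zero) p
  productTail⁻-k≡0 xs zero    zero    = ≡.refl
  productTail⁻-k≡0 xs zero    (suc m) = ≡.refl
  productTail⁻-k≡0 xs (suc p) m       = productTail-k≡0 xs p m

  pre-productTail-m≡0 : ∀ xs p k → pre (productTail xs p zero) k ≡ pre (productTerm xs p zero) k
  pre-productTail-m≡0 xs p zero    = ≡.refl
  pre-productTail-m≡0 xs p (suc k) = ≡.refl

  -- `productTerm-∷` summed along the diagonal. A squared x lowers the number of squares and so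
  -- starts the tail one step earlier; a simple x lowers one of the two degrees.
  productTail-∷ : ∀ x xs p m k →
    productTail (x ∷ xs) p m k ≈
      productTail xs p m k +
      (x * x * productTail⁻ xs p m k +
       x * (pre (λ m′ → productTail xs p m′ k) m + pre (productTail xs p m) k))
  -- When m or k is 0 every tail that occurs collapses to at most one term, leaving `productTerm-∷`.
  productTail-∷ x xs p zero    k
    rewrite productTail⁻-m≡0 xs p k | pre-productTail-m≡0 xs p k = productTerm-∷ x xs p zero k
  productTail-∷ x xs p (suc m) zero
    rewrite productTail⁻-k≡0 xs p (suc m) | productTail-k≡0 xs p m = productTerm-∷ x xs p (suc m) zero
  productTail-∷ x xs p (suc m) (suc k) = begin
    productTerm (x ∷ xs) p (suc m) (suc k) + productTail (x ∷ xs) (suc p) m k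
      ≈⟨ +-cong (productTerm-∷ x xs p (suc m) (suc k)) (productTail-∷ x xs (suc p) m k) ⟩
    t + (x * x * t₂ + x * (tˡ + tʳ)) + (g + (x * x * g₂ + x * (gˡ + gʳ)))
      ≈⟨ solve 9 (λ x t t₂ tˡ tʳ g g₂ gˡ gʳ →
           t :+ (x :* x :* t₂ :+ x :* (tˡ :+ tʳ)) :+ (g :+ (x :* x :* g₂ :+ x :* (gˡ :+ gʳ)))
             := (t :+ g) :+ (x :* x :* (t₂ :+ g₂) :+ x :* ((tˡ :+ gˡ) :+ (tʳ :+ gʳ))))
           refl x t t₂ tˡ tʳ g g₂ gˡ gʳ ⟩
    (t + g) + (x * x * (t₂ + g₂) + x * ((tˡ + gˡ) + (tʳ + gʳ)))
      ≈⟨ +-congˡ (+-cong (*-congˡ (productTail⁻-suc xs p m k))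
           (*-congˡ (+-cong (productTail-unfoldˡ xs p m k) (productTail-unfoldʳ xs p m k)))) ⟨
    _ ∎
    where
    t  = productTerm xs p (suc m) (suc k)
    t₂ = pre (λ p′ → productTerm xs p′ (suc m) (suc k)) p
    tˡ = productTerm xs p m (suc k)
    tʳ = productTerm xs p (suc m) k
    g  = productTail xs (suc p) m k
    g₂ = productTail xs p m k
    gˡ = pre (λ m′ → productTail xs (suc p) m′ k) m
    gʳ = pre (productTail xs (suc p) m) k

  productTail-suc-[] : ∀ p m k → productTail [] (suc p) m k ≈ 0#
  productTail-suc-[] p zero    k       = n×0≈0 (k C k)
  productTail-suc-[] p (suc m) zero    = n×0≈0 ((suc m ℕ.+ 0) C 0)
  productTail-suc-[] p (suc m) (suc k) =
    trans (+-cong (n×0≈0 ((suc m ℕ.+ suc k) C suc k)) (productTail-suc-[] (suc p) m k)) (+-identityˡ 0#)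

  -- Adjoining x replaces each factor e by `e + x * pre e`. The four products obtained are the
  -- pieces of `productTail-∷` at p = 0, where the x² piece is shifted in both degrees.
  elementary-*-elementary : ∀ xs m k →
    productTail xs 0 m k ≈ elementary xs m * elementary xs k
  elementary-*-elementary []       zero    zero    = trans (×-homo-1 1#) (sym (*-identityˡ 1#))
  elementary-*-elementary []       zero    (suc k) = trans (n×0≈0 (suc k C suc k)) (sym (zeroʳ _))
  elementary-*-elementary []       (suc m) zero    =
    trans (n×0≈0 ((suc m ℕ.+ 0) C 0)) (sym (zeroˡ _))
  elementary-*-elementary []       (suc m) (suc k) =
    trans (+-cong (n×0≈0 ((suc m ℕ.+ suc k) C suc k)) (productTail-suc-[] 0 m k))
          (trans (+-identityˡ 0#) (sym (zeroˡ _)))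
  elementary-*-elementary (x ∷ xs) m k = begin
    productTail (x ∷ xs) 0 m k
      ≈⟨ productTail-∷ x xs 0 m k ⟩
    productTail xs 0 m k +
      (x * x * pre (λ m′ → pre (productTail xs 0 m′) k) m +
       x * (pre (λ m′ → productTail xs 0 m′ k) m + pre (productTail xs 0 m) k))
      ≈⟨ +-cong (ih m k) (+-cong
           (*-congˡ (pre-*ʳ (λ m′ → pre-*ˡ (ih m′) k) m))
           (*-congˡ (+-cong (pre-*ʳ (λ m′ → ih m′ k) m) (pre-*ˡ (ih m) k)))) ⟩
    e m * e k + (x * x * (pre e m * pre e k) + x * (pre e m * e k + e m * pre e k))
      ≈⟨ solve 5 (λ x a a⁻ b b⁻ →
           a :* b :+ (x :* x :* (a⁻ :* b⁻) :+ x :* (a⁻ :* b :+ a :* b⁻))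
             := (a :+ x :* a⁻) :* (b :+ x :* b⁻))
           refl x (e m) (pre e m) (e k) (pre e k) ⟩
    (e m + x * pre e m) * (e k + x * pre e k) ∎
    where
    e  = elementary xs
    ih = elementary-*-elementary xs

  -- Generating function of the elementary symmetric polynomials

  -- Horner's scheme for the polynomial with the n coefficients f 0, ..., f (n - 1).
  eval : (ℕ → Carrier) → ℕ → Carrier → Carrier
  eval f zero    s = 0#
  eval f (suc n) s = f 0 + s * eval (f ∘ suc) n s

  eval-cong : ∀ {f g} → (∀ k → f k ≈ g k) → ∀ n s → eval f n s ≈ eval g n s
  eval-cong f≈g zero    s = refl
  eval-cong f≈g (suc n) s = +-cong (f≈g 0) (*-congˡ (eval-cong (f≈g ∘ suc) n s))

  eval-linear : ∀ f g a n s → eval (λ k → f k + a * g k) n s ≈ eval f n s + a * eval g n s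
  eval-linear f g a zero    s = solve 1 (λ a → con 0 := con 0 :+ a :* con 0) refl a
  eval-linear f g a (suc n) s = trans
    (+-congˡ (*-congˡ (eval-linear (f ∘ suc) (g ∘ suc) a n s)))
    (solve 6 (λ f₀ g₀ f g a s → (f₀ :+ a :* g₀) :+ s :* (f :+ a :* g)
                                  := (f₀ :+ s :* f) :+ a :* (g₀ :+ s :* g))
      refl (f 0) (g 0) (eval (f ∘ suc) n s) (eval (g ∘ suc) n s) a s)

  eval-*ˡ : ∀ f a n s → eval (λ k → a * f k) n s ≈ a * eval f n s
  eval-*ˡ f a zero    s = sym (zeroʳ a)
  eval-*ˡ f a (suc n) s = trans
    (+-congˡ (*-congˡ (eval-*ˡ (f ∘ suc) a n s)))
    (solve 4 (λ f₀ f a s → a :* f₀ :+ s :* (a :* f) := a :* (f₀ :+ s :* f))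
      refl (f 0) (eval (f ∘ suc) n s) a s)

  ∏[1+_*s] : List Carrier → Carrier → Carrier
  ∏[1+ []     *s] s = 1#
  ∏[1+ x ∷ xs *s] s = (1# + x * s) * ∏[1+ xs *s] s

  -- The length bound is an inequality because the induction step reads the coefficients of the same
  -- shorter product twice, up to two different degrees.
  eval-elementary : ∀ xs n s → length xs ℕ.≤ n → eval (elementary xs) (suc n) s ≈ ∏[1+ xs *s] s
  eval-elementary [] n s _ = begin
    1# + s * eval (λ _ → 0#) n s ≈⟨ +-congˡ (*-congˡ (eval-zero n)) ⟩
    1# + s * 0#                  ≈⟨ solve 1 (λ s → con 1 :+ s :* con 0 := con 1) refl s ⟩
    1#                           ∎
    where
    eval-zero : ∀ n → eval (λ _ → 0#) n s ≈ 0#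
    eval-zero zero    = refl
    eval-zero (suc n) = trans (+-identityˡ _) (trans (*-congˡ (eval-zero n)) (zeroʳ s))
  eval-elementary (x ∷ xs) (suc n) s (s≤s l) = begin
    (e 0 + x * 0#) + s * eval (λ k → e (suc k) + x * e k) (suc n) s
      ≈⟨ +-congˡ (*-congˡ (eval-linear (e ∘ suc) e x (suc n) s)) ⟩
    (e 0 + x * 0#) + s * (eval (e ∘ suc) (suc n) s + x * eval e (suc n) s)
      ≈⟨ solve 5 (λ e₀ x s a b → (e₀ :+ x :* con 0) :+ s :* (a :+ x :* b)
                                   := (e₀ :+ s :* a) :+ x :* s :* b)
           refl (e 0) x s (eval (e ∘ suc) (suc n) s) (eval e (suc n) s) ⟩
    eval e (suc (suc n)) s + x * s * eval e (suc n) s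
      ≈⟨ +-cong (eval-elementary xs (suc n) s (ℕ.m≤n⇒m≤1+n l)) (*-congˡ (eval-elementary xs n s l)) ⟩
    ∏[1+ xs *s] s + x * s * ∏[1+ xs *s] s
      ≈⟨ solve 3 (λ x s p → p :+ x :* s :* p := (con 1 :+ x :* s) :* p) refl x s (∏[1+ xs *s] s) ⟩
    (1# + x * s) * ∏[1+ xs *s] s ∎
    where e = elementary xs

  elementary-0 : ∀ xs → elementary xs 0 ≈ 1#
  elementary-0 []       = refl
  elementary-0 (x ∷ xs) = trans (+-congˡ (zeroʳ x)) (trans (+-identityʳ _) (elementary-0 xs))

  elementary-vanishes : ∀ xs k → length xs ℕ.< k → elementary xs k ≈ 0#
  elementary-vanishes []       (suc k) _       = refl
  elementary-vanishes (x ∷ xs) (suc k) (s≤s l) = begin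
    elementary xs (suc k) + x * elementary xs k
      ≈⟨ +-cong (elementary-vanishes xs (suc k) (ℕ.m<n⇒m<1+n l)) (*-congˡ (elementary-vanishes xs k l)) ⟩
    0# + x * 0#
      ≈⟨ solve 1 (λ x → con 0 :+ x :* con 0 := con 0) refl x ⟩
    0# ∎

  elementary-replicate : ∀ n k → elementary (replicate n 1#) k ≈ (n C k) · 1#
  elementary-replicate zero    zero    = sym (×-homo-1 1#)
  elementary-replicate zero    (suc k) = refl
  elementary-replicate (suc n) zero    = trans (elementary-0 (replicate (suc n) 1#)) (sym (×-homo-1 1#))
  elementary-replicate (suc n) (suc k) = begin
    elementary (replicate n 1#) (suc k) + 1# * elementary (replicate n 1#) k
      ≈⟨ +-cong (elementary-replicate n (suc k)) (trans (*-identityˡ _) (elementary-replicate n k)) ⟩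
    (n C suc k) · 1# + (n C k) · 1#
      ≈⟨ +-comm _ _ ⟩
    (n C k) · 1# + (n C suc k) · 1#
      ≈⟨ ×-homo-+ 1# (n C k) (n C suc k) ⟨
    (n C k ℕ.+ n C suc k) · 1#
      ≡⟨ ≡.cong (_· 1#) (nCk+nC[k+1]≡[n+1]C[k+1] n k) ⟩
    (suc n C suc k) · 1# ∎

  ∏-replicate : ∀ n s → ∏[1+ replicate n 1# *s] s ≈ (1# + s) ^ n
  ∏-replicate zero    s = refl
  ∏-replicate (suc n) s = *-cong (+-congˡ (*-identityˡ s)) (∏-replicate n s)

  -- The special case of `eval-elementary` in which all n variables are 1.
  binomial-theorem : ∀ n s → eval (λ k → (n C k) · 1#) (suc n) s ≈ (1# + s) ^ n
  binomial-theorem n s = begin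
    eval (λ k → (n C k) · 1#) (suc n) s
      ≈⟨ eval-cong (elementary-replicate n) (suc n) s ⟨
    eval (elementary (replicate n 1#)) (suc n) s
      ≈⟨ eval-elementary (replicate n 1#) n s (ℕ.≤-reflexive (length-replicate n)) ⟩
    ∏[1+ replicate n 1# *s] s
      ≈⟨ ∏-replicate n s ⟩
    (1# + s) ^ n ∎

-- Polynomials determined by their values

module PolynomialRoots {c ℓ} (R : CommutativeRing c ℓ) where

  open CommutativeRing R renaming (zero to *-zero)
  open import Algebra.Properties.Ring ring using ([y-z]x≈yx-zx; -1*x≈-x)
  open import Algebra.Properties.AbelianGroup +-abelianGroup using (x∙y⁻¹≈ε⇒x≈y; x≈y⇒x∙y⁻¹≈ε)
  open import Algebra.Solver.Ring.NaturalCoefficients.Default commutativeSemiring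
    using (solve; _:+_; _:*_; _:=_; con)
  open import Relation.Binary.Reasoning.Setoid setoid
  open SymmetricPolynomials commutativeSemiring using (eval; eval-linear)

  -- The coefficients of (f(s) - f(r)) / (s - r), where f has degree ≤ n.
  quotient : (ℕ → Carrier) → ℕ → Carrier → ℕ → Carrier
  quotient f zero    r k       = 0#
  quotient f (suc n) r zero    = eval (f ∘ suc) (suc n) r
  quotient f (suc n) r (suc k) = quotient (f ∘ suc) n r k

  -- f(s) - f(r) = (s - r) q(s), with both sides moved so that no subtraction occurs.
  eval-quotient : ∀ f n r s →
    eval f (suc n) s + r * eval (quotient f n r) n s ≈ eval f (suc n) r + s * eval (quotient f n r) n s
  eval-quotient f zero    r s =
    solve 3 (λ f₀ r s → (f₀ :+ s :* con 0) :+ r :* con 0 := (f₀ :+ r :* con 0) :+ s :* con 0)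
      refl (f 0) r s
  eval-quotient f (suc n) r s = begin
    (f 0 + s * p s) + r * (p r + s * q)
      ≈⟨ solve 6 (λ f₀ r s pr ps q → (f₀ :+ s :* ps) :+ r :* (pr :+ s :* q)
                                       := (f₀ :+ r :* pr) :+ s :* (ps :+ r :* q))
           refl (f 0) r s (p r) (p s) q ⟩
    (f 0 + r * p r) + s * (p s + r * q)
      ≈⟨ +-congˡ (*-congˡ (eval-quotient (f ∘ suc) n r s)) ⟩
    (f 0 + r * p r) + s * (p r + s * q) ∎
    where
    p = eval (f ∘ suc) (suc n)
    q = eval (quotient (f ∘ suc) n r) n s

  -- The lowest coefficient of the quotient is the value of `f ∘ suc` at r. Its vanishing therefore
  -- yields f 0 = f(r) = 0 and also the root hypothesis for the induction on `f ∘ suc`.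
  quotient-zero : ∀ f n r → eval f (suc n) r ≈ 0# → (∀ k → k ℕ.< n → quotient f n r k ≈ 0#) →
                  ∀ k → k ℕ.≤ n → f k ≈ 0#
  quotient-zero f zero    r fr≈0 q≈0 zero    _       =
    trans (solve 2 (λ f₀ r → f₀ := f₀ :+ r :* con 0) refl (f 0) r) fr≈0
  quotient-zero f (suc n) r fr≈0 q≈0 zero    _       = begin
    f 0                                  ≈⟨ solve 2 (λ f₀ r → f₀ := f₀ :+ r :* con 0) refl (f 0) r ⟩
    f 0 + r * 0#                         ≈⟨ +-congˡ (*-congˡ (q≈0 0 (s≤s z≤n))) ⟨
    f 0 + r * eval (f ∘ suc) (suc n) r   ≈⟨ fr≈0 ⟩
    0#                                   ∎
  quotient-zero f (suc n) r fr≈0 q≈0 (suc k) (s≤s l) =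
    quotient-zero (f ∘ suc) n r (q≈0 0 (s≤s z≤n)) (λ k k<n → q≈0 (suc k) (s≤s k<n)) k l

  -- Division by s - r 0 leaves a polynomial with one coefficient fewer that vanishes at the
  -- remaining points. Distinctness of the points is expressed as cancellability of their
  -- differences, which makes sense in any commutative ring.
  coefficients-zero : ∀ n f (r : ℕ → Carrier) →
    (∀ i j → i ℕ.< j → j ℕ.< n → ∀ y → (r j - r i) * y ≈ 0# → y ≈ 0#) →
    (∀ i → i ℕ.< n → eval f n (r i) ≈ 0#) →
    ∀ k → k ℕ.< n → f k ≈ 0#
  coefficients-zero (suc n) f r cancel root k (s≤s k≤n) =
    quotient-zero f n (r 0) (root 0 (s≤s z≤n))
      (coefficients-zero n q (r ∘ suc)
        (λ i j i<j j<n → cancel (suc i) (suc j) (s≤s i<j) (s≤s j<n))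
        (λ i i<n → cancel 0 (suc i) (s≤s z≤n) (s≤s i<n) _ (root-q i i<n)))
      k k≤n
    where
    q = quotient f n (r 0)
    root-q : ∀ i → i ℕ.< n → (r (suc i) - r 0) * eval q n (r (suc i)) ≈ 0#
    root-q i i<n = begin
      (s - r 0) * y        ≈⟨ [y-z]x≈yx-zx y s (r 0) ⟩
      s * y - r 0 * y      ≈⟨ x≈y⇒x∙y⁻¹≈ε sy≈r₀y ⟩
      0#                   ∎
      where
      s = r (suc i)
      y = eval q n s
      sy≈r₀y : s * y ≈ r 0 * y
      sy≈r₀y = begin
        s * y                           ≈⟨ +-identityˡ _ ⟨
        0# + s * y                      ≈⟨ +-congʳ (root 0 (s≤s z≤n)) ⟨
        eval f (suc n) (r 0) + s * y    ≈⟨ eval-quotient f n (r 0) s ⟨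
        eval f (suc n) s + r 0 * y      ≈⟨ +-congʳ (root (suc i) (s≤s i<n)) ⟩
        0# + r 0 * y                    ≈⟨ +-identityˡ _ ⟩
        r 0 * y                         ∎

  coefficients-unique : ∀ n f g (r : ℕ → Carrier) →
    (∀ i j → i ℕ.< j → j ℕ.< n → ∀ y → (r j - r i) * y ≈ 0# → y ≈ 0#) →
    (∀ i → i ℕ.< n → eval f n (r i) ≈ eval g n (r i)) →
    ∀ k → k ℕ.< n → f k ≈ g k
  coefficients-unique n f g r cancel agree k k<n = x∙y⁻¹≈ε⇒x≈y (f k) (g k) (begin
    -- The difference is written with the factor -1 so that `eval-linear` applies to it.
    f k - g k          ≈⟨ +-congˡ (-1*x≈-x (g k)) ⟨
    f k + - 1# * g k   ≈⟨ coefficients-zero n _ r cancel root k k<n ⟩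
    0#                 ∎)
    where
    root : ∀ i → i ℕ.< n → eval (λ k → f k + - 1# * g k) n (r i) ≈ 0#
    root i i<n = begin
      eval (λ k → f k + - 1# * g k) n (r i)      ≈⟨ eval-linear f g (- 1#) n (r i) ⟩
      eval f n (r i) + - 1# * eval g n (r i)     ≈⟨ +-congˡ (-1*x≈-x _) ⟩
      eval f n (r i) - eval g n (r i)            ≈⟨ x≈y⇒x∙y⁻¹≈ε (agree i i<n) ⟩
      0#                                         ∎

-- Absorption identity for binomial coefficients

[k+1]*[n+1]C[k+1]≡[n+1]*nCk : ∀ n k → suc k ℕ.* (suc n C suc k) ≡ suc n ℕ.* (n C k)
[k+1]*[n+1]C[k+1]≡[n+1]*nCk zero    zero    = ≡.refl
[k+1]*[n+1]C[k+1]≡[n+1]*nCk zero    (suc k) = ℕ.*-zeroʳ k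
[k+1]*[n+1]C[k+1]≡[n+1]*nCk (suc n) zero    =
  ≡.trans (ℕ.*-identityˡ _) (≡.trans (nC1≡n (suc (suc n))) (≡.sym (ℕ.*-identityʳ _)))
[k+1]*[n+1]C[k+1]≡[n+1]*nCk (suc n) (suc k) = begin
  suc (suc k) ℕ.* (suc (suc n) C suc (suc k))
    ≡⟨ ≡.cong (suc (suc k) ℕ.*_) (nCk+nC[k+1]≡[n+1]C[k+1] (suc n) (suc k)) ⟨
  suc (suc k) ℕ.* (u ℕ.+ v)
    ≡⟨ split k u v ⟩
  suc k ℕ.* u ℕ.+ u ℕ.+ suc (suc k) ℕ.* v
    ≡⟨ ≡.cong₂ (λ a b → a ℕ.+ u ℕ.+ b) ([k+1]*[n+1]C[k+1]≡[n+1]*nCk n k)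
                                         ([k+1]*[n+1]C[k+1]≡[n+1]*nCk n (suc k)) ⟩
  suc n ℕ.* (n C k) ℕ.+ u ℕ.+ suc n ℕ.* (n C suc k)
    ≡⟨ merge n (n C k) u (n C suc k) ⟩
  suc n ℕ.* (n C k ℕ.+ n C suc k) ℕ.+ u
    ≡⟨ ≡.cong (λ w → suc n ℕ.* w ℕ.+ u) (nCk+nC[k+1]≡[n+1]C[k+1] n k) ⟩
  suc n ℕ.* u ℕ.+ u
    ≡⟨ ℕ.+-comm (suc n ℕ.* u) u ⟩
  suc (suc n) ℕ.* u ∎
  where
  open ≡.≡-Reasoning
  u = suc n C suc k
  v = suc n C suc (suc k)
  split : ∀ k u v → suc (suc k) ℕ.* (u ℕ.+ v) ≡ suc k ℕ.* u ℕ.+ u ℕ.+ suc (suc k) ℕ.* v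
  split = ℕ-Solver.solve-∀
  merge : ∀ n a u b → suc n ℕ.* a ℕ.+ u ℕ.+ suc n ℕ.* b ≡ suc n ℕ.* (a ℕ.+ b) ℕ.+ u
  merge = ℕ-Solver.solve-∀

-- Integer arithmetic of the block lengths

private
  p+j-j≡p : ∀ p j → p ℤ.+ j ℤ.- j ≡ p
  p+j-j≡p = ℤ-solve-∀

  twos≡-[1+d] : ∀ ℓ d → ℓ ℤ.- (+ 1 ℤ.+ (ℓ ℤ.+ d)) ≡ ℤ.- (+ 1 ℤ.+ d)
  twos≡-[1+d] = ℤ-solve-∀

  -- The left side has the shape that `rewrite` meets: `2 ℕ.* j` unfolds to j + (j + 0). In the
  -- lemmas around it, `+ 1 ℤ.+ d` likewise stands for a successor.
  ones≡r+j : ∀ p r j → p ℤ.+ r ℤ.- (p ℤ.+ j) ℤ.+ (j ℤ.+ (j ℤ.+ + 0)) ≡ r ℤ.+ j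
  ones≡r+j = ℤ-solve-∀

  ones≡e : ∀ m d e → m ℤ.- (+ 1 ℤ.+ (m ℤ.+ d) ℤ.+ (+ 1 ℤ.+ (d ℤ.+ e)))
                       ℤ.+ (+ 1 ℤ.+ (d ℤ.+ e) ℤ.+ (+ 1 ℤ.+ (d ℤ.+ e) ℤ.+ + 0)) ≡ e
  ones≡e = ℤ-solve-∀

  ones≡-[1+e] : ∀ m j e → m ℤ.- (+ 1 ℤ.+ (m ℤ.+ (j ℤ.+ e)) ℤ.+ j) ℤ.+ (j ℤ.+ (j ℤ.+ + 0))
                            ≡ ℤ.- (+ 1 ℤ.+ e)
  ones≡-[1+e] = ℤ-solve-∀

-- Finite sums

module HeytingFieldSums {c ℓ₁ ℓ₂} (F : HeytingField c ℓ₁ ℓ₂) where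

  open HeytingField F using (heytingCommutativeRing; _#_; #⇒invertible)
  open CommutativeRing (HeytingCommutativeRing.commutativeRing heytingCommutativeRing)
    renaming (refl to ≈-refl; sym to ≈-sym; trans to ≈-trans; zero to *-zero)
  open RootOfUnitySums F
  open import Algebra.Properties.AbelianGroup +-abelianGroup using (x≈y⇒x∙y⁻¹≈ε; x∙y⁻¹≈ε⇒x≈y)
  open import Algebra.Properties.Ring ring using (-0#≈0#; +-cancelˡ; [y-z]x≈yx-zx)
  open import Algebra.Properties.Semiring.Mult semiring using (×-assoc-*; ×-congʳ; ×1-homo-*; ×-homo-1) renaming (_×_ to _·_)
  open import Algebra.Properties.Semiring.Exp semiring using (_^_; ^-homo-*; ^-congˡ; ^-assocʳ)
  open import Algebra.Solver.Ring.NaturalCoefficients.Default commutativeSemiring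
    using (solve; _:+_; _:*_; _:=_; con)
  open import Relation.Binary.Reasoning.Setoid setoid
  open SymmetricPolynomials commutativeSemiring
  open PolynomialRoots (HeytingCommutativeRing.commutativeRing heytingCommutativeRing)

  module _ {a} {A : Set a} where

    sumOver-++ : ∀ (xs ys : List A) f → sumOver (xs ++ ys) f ≈ sumOver xs f + sumOver ys f
    sumOver-++ []       ys f = ≈-sym (+-identityˡ _)
    sumOver-++ (x ∷ xs) ys f = ≈-trans (+-congˡ (sumOver-++ xs ys f)) (≈-sym (+-assoc _ _ _))

    sumOver-cong : ∀ (xs : List A) {f g} → (∀ x → f x ≈ g x) → sumOver xs f ≈ sumOver xs g
    sumOver-cong []       f≈g = ≈-refl
    sumOver-cong (x ∷ xs) f≈g = +-cong (f≈g x) (sumOver-cong xs f≈g)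

    sumOver-+ : ∀ (xs : List A) f g → sumOver xs (λ x → f x + g x) ≈ sumOver xs f + sumOver xs g
    sumOver-+ []       f g = ≈-sym (+-identityˡ 0#)
    sumOver-+ (x ∷ xs) f g = ≈-trans (+-congˡ (sumOver-+ xs f g))
      (solve 4 (λ a b c d → (a :+ b) :+ (c :+ d) := (a :+ c) :+ (b :+ d)) ≈-refl _ _ _ _)

    sumOver-*ˡ : ∀ (xs : List A) y f → sumOver xs (λ x → y * f x) ≈ y * sumOver xs f
    sumOver-*ˡ []       y f = ≈-sym (zeroʳ y)
    sumOver-*ˡ (x ∷ xs) y f = ≈-trans (+-congˡ (sumOver-*ˡ xs y f)) (≈-sym (distribˡ _ _ _))

    sumOver-0 : ∀ (xs : List A) → sumOver xs (λ _ → 0#) ≈ 0#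
    sumOver-0 []       = ≈-refl
    sumOver-0 (x ∷ xs) = ≈-trans (+-identityˡ _) (sumOver-0 xs)

    sumOver-map : ∀ {b} {B : Set b} (g : B → A) xs f → sumOver (map g xs) f ≡ sumOver xs (f ∘ g)
    sumOver-map g []       f = ≡.refl
    sumOver-map g (x ∷ xs) f = ≡.cong (λ y → f (g x) + y) (sumOver-map g xs f)

    sumOver-↭ : ∀ {xs ys : List A} f → xs ↭ ys → sumOver xs f ≈ sumOver ys f
    sumOver-↭ f ↭.refl      = ≈-refl
    sumOver-↭ f (↭.prep x p)    = +-congˡ (sumOver-↭ f p)
    sumOver-↭ f (↭.swap x y p)  = ≈-trans (+-congˡ (+-congˡ (sumOver-↭ f p)))
      (solve 3 (λ a b c → a :+ (b :+ c) := b :+ (a :+ c)) ≈-refl _ _ _)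
    sumOver-↭ f (↭.trans p q)   = ≈-trans (sumOver-↭ f p) (sumOver-↭ f q)

  sumOver-upTo-suc : ∀ n f → sumOver (upTo (suc n)) f ≈ sumOver (upTo n) f + f n
  sumOver-upTo-suc n f = begin
    sumOver (upTo (suc n)) f         ≡⟨ ≡.cong (λ ns → sumOver ns f) (upTo-∷ʳ n) ⟨
    sumOver (upTo n ++ n ∷ []) f     ≈⟨ sumOver-++ (upTo n) (n ∷ []) f ⟩
    sumOver (upTo n) f + (f n + 0#)  ≈⟨ +-congˡ (+-identityʳ (f n)) ⟩
    sumOver (upTo n) f + f n         ∎

  sumOver-upTo-zero : ∀ n {f} → (∀ j → j ℕ.< n → f j ≈ 0#) → sumOver (upTo n) f ≈ 0#
  sumOver-upTo-zero zero        f≈0 = ≈-refl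
  sumOver-upTo-zero (suc n) {f} f≈0 = begin
    sumOver (upTo (suc n)) f   ≈⟨ sumOver-upTo-suc n f ⟩
    sumOver (upTo n) f + f n   ≈⟨ +-cong (sumOver-upTo-zero n (λ j j<n → f≈0 j (ℕ.m<n⇒m<1+n j<n)))
                                         (f≈0 n ℕ.≤-refl) ⟩
    0# + 0#                    ≈⟨ +-identityˡ 0# ⟩
    0#                         ∎

  sumOver-upTo-extend : ∀ n d {f} → (∀ j → n ℕ.≤ j → f j ≈ 0#) →
                        sumOver (upTo (d ℕ.+ n)) f ≈ sumOver (upTo n) f
  sumOver-upTo-extend n zero        f≈0 = ≈-refl
  sumOver-upTo-extend n (suc d) {f} f≈0 = begin
    sumOver (upTo (suc (d ℕ.+ n))) f            ≈⟨ sumOver-upTo-suc (d ℕ.+ n) f ⟩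
    sumOver (upTo (d ℕ.+ n)) f + f (d ℕ.+ n)    ≈⟨ +-cong (sumOver-upTo-extend n d f≈0)
                                                          (f≈0 _ (ℕ.m≤n+m n d)) ⟩
    sumOver (upTo n) f + 0#                     ≈⟨ +-identityʳ _ ⟩
    sumOver (upTo n) f                          ∎

  -- Both sums extend by zeros to the range of length n + k, which avoids deciding which of n and k
  -- is larger.
  sumOver-upTo-truncate : ∀ n k {f} → (∀ j → n ℕ.≤ j → f j ≈ 0#) → (∀ j → k ℕ.≤ j → f j ≈ 0#) →
                          sumOver (upTo n) f ≈ sumOver (upTo k) f
  sumOver-upTo-truncate n k {f} f≈0 f≈0′ = begin
    sumOver (upTo n) f          ≈⟨ sumOver-upTo-extend n k f≈0 ⟨
    sumOver (upTo (k ℕ.+ n)) f  ≡⟨ ≡.cong (λ i → sumOver (upTo i) f) (ℕ.+-comm k n) ⟩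
    sumOver (upTo (n ℕ.+ k)) f  ≈⟨ sumOver-upTo-extend k n f≈0′ ⟩
    sumOver (upTo k) f          ∎

  -- From nested sums to monomial symmetric polynomials

  -- ∑ x_{i₁} ^ s₁ ⋯ x_{iₖ} ^ sₖ over i₁ < ⋯ < iₖ, for σ = (s₁, …, sₖ).
  quasi : List Carrier → List ℕ → Carrier
  quasi _        []      = 1#
  quasi []       (s ∷ σ) = 0#
  quasi (x ∷ xs) (s ∷ σ) = x ^ s * quasi xs σ + quasi xs (s ∷ σ)

  -- Both sides split according to whether the first index is chosen.
  sum-choose≈quasi : ∀ {a} {A : Set a} (f : A → Carrier) js σ →
    sumOver (choose (length σ) js) (λ is → product (zipWith (λ i s → f i ^ s) is σ))
      ≈ quasi (map f js) σ
  sum-choose≈quasi f []       []      = +-identityʳ 1#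
  sum-choose≈quasi f (j ∷ js) []      = +-identityʳ 1#
  sum-choose≈quasi f []       (s ∷ σ) = ≈-refl
  sum-choose≈quasi f (j ∷ js) (s ∷ σ) = begin
    sumOver (map (j ∷_) (choose (length σ) js) ++ choose (suc (length σ)) js) (term (s ∷ σ))
      ≈⟨ sumOver-++ (map (j ∷_) (choose (length σ) js)) _ _ ⟩
    sumOver (map (j ∷_) (choose (length σ) js)) (term (s ∷ σ)) + rest
      ≡⟨ ≡.cong (_+ rest) (sumOver-map (j ∷_) (choose (length σ) js) (term (s ∷ σ))) ⟩
    sumOver (choose (length σ) js) (λ is → f j ^ s * term σ is) + rest
      ≈⟨ +-cong (sumOver-*ˡ (choose (length σ) js) (f j ^ s) (term σ)) (sum-choose≈quasi f js (s ∷ σ)) ⟩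
    f j ^ s * sumOver (choose (length σ) js) (term σ) + quasi (map f js) (s ∷ σ)
      ≈⟨ +-congʳ (*-congˡ (sum-choose≈quasi f js σ)) ⟩
    f j ^ s * quasi (map f js) σ + quasi (map f js) (s ∷ σ) ∎
    where
    term : List ℕ → List _ → Carrier
    term σ is = product (zipWith (λ i s → f i ^ s) is σ)
    rest = sumOver (choose (suc (length σ)) js) (term (s ∷ σ))

  sum-map∷-quasi-[] : ∀ s V → sumOver (map (s ∷_) V) (quasi []) ≈ 0#
  sum-map∷-quasi-[] s V =
    ≈-trans (reflexive (sumOver-map (s ∷_) V (quasi []))) (sumOver-0 V)

  sum-map∷-quasi-∷ : ∀ x xs s V →
    sumOver (map (s ∷_) V) (quasi (x ∷ xs))
      ≈ x ^ s * sumOver V (quasi xs) + sumOver (map (s ∷_) V) (quasi xs)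
  sum-map∷-quasi-∷ x xs s V = begin
    sumOver (map (s ∷_) V) (quasi (x ∷ xs))
      ≡⟨ sumOver-map (s ∷_) V (quasi (x ∷ xs)) ⟩
    sumOver V (λ σ → x ^ s * quasi xs σ + quasi xs (s ∷ σ))
      ≈⟨ sumOver-+ V _ _ ⟩
    sumOver V (λ σ → x ^ s * quasi xs σ) + sumOver V (λ σ → quasi xs (s ∷ σ))
      ≈⟨ +-cong (sumOver-*ˡ V _ _) (reflexive (≡.sym (sumOver-map (s ∷_) V (quasi xs)))) ⟩
    x ^ s * sumOver V (quasi xs) + sumOver (map (s ∷_) V) (quasi xs) ∎

  -- Indices increase along a word, so the first variable x can carry only the first exponent. Since
  -- `twoOneWords` is grouped by first letter, the cases x², x and x absent match the recursion of
  -- `monomial`.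
  sum-quasi≈monomial : ∀ xs a b → sumOver (twoOneWords a b) (quasi xs) ≈ monomial xs a b
  sum-quasi≈monomial []       zero    zero    = +-identityʳ 1#
  sum-quasi≈monomial []       zero    (suc b) = sum-map∷-quasi-[] 1 (twoOneWords zero b)
  sum-quasi≈monomial []       (suc a) zero    = sum-map∷-quasi-[] 2 (twoOneWords a zero)
  sum-quasi≈monomial []       (suc a) (suc b) = begin
    sumOver (map (2 ∷_) (twoOneWords a (suc b)) ++ map (1 ∷_) (twoOneWords (suc a) b)) (quasi [])
      ≈⟨ sumOver-++ (map (2 ∷_) (twoOneWords a (suc b))) _ _ ⟩
    sumOver (map (2 ∷_) (twoOneWords a (suc b))) (quasi []) +
    sumOver (map (1 ∷_) (twoOneWords (suc a) b)) (quasi [])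
      ≈⟨ +-cong (sum-map∷-quasi-[] 2 (twoOneWords a (suc b)))
                (sum-map∷-quasi-[] 1 (twoOneWords (suc a) b)) ⟩
    0# + 0#
      ≈⟨ +-identityˡ 0# ⟩
    0# ∎
  sum-quasi≈monomial (x ∷ xs) zero    zero    = ≈-trans (sum-quasi≈monomial xs 0 0)
    (solve 2 (λ m x → m := m :+ (x :* x :* con 0 :+ x :* con 0)) ≈-refl (monomial xs 0 0) x)
  sum-quasi≈monomial (x ∷ xs) zero    (suc b) = begin
    sumOver (twoOneWords zero (suc b)) (quasi (x ∷ xs))
      ≈⟨ sum-map∷-quasi-∷ x xs 1 (twoOneWords zero b) ⟩
    x ^ 1 * sumOver (twoOneWords zero b) (quasi xs) + sumOver (twoOneWords zero (suc b)) (quasi xs)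
      ≈⟨ +-cong (*-congˡ (sum-quasi≈monomial xs zero b)) (sum-quasi≈monomial xs zero (suc b)) ⟩
    x ^ 1 * monomial xs zero b + monomial xs zero (suc b)
      ≈⟨ solve 3 (λ x u v → x :* con 1 :* u :+ v := v :+ (x :* x :* con 0 :+ x :* u)) ≈-refl x _ _ ⟩
    monomial (x ∷ xs) zero (suc b) ∎
  sum-quasi≈monomial (x ∷ xs) (suc a) zero    = begin
    sumOver (twoOneWords (suc a) zero) (quasi (x ∷ xs))
      ≈⟨ sum-map∷-quasi-∷ x xs 2 (twoOneWords a zero) ⟩
    x ^ 2 * sumOver (twoOneWords a zero) (quasi xs) + sumOver (twoOneWords (suc a) zero) (quasi xs)
      ≈⟨ +-cong (*-congˡ (sum-quasi≈monomial xs a zero)) (sum-quasi≈monomial xs (suc a) zero) ⟩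
    x ^ 2 * monomial xs a zero + monomial xs (suc a) zero
      ≈⟨ solve 3 (λ x u v → x :* (x :* con 1) :* u :+ v := v :+ (x :* x :* u :+ x :* con 0)) ≈-refl x _ _ ⟩
    monomial (x ∷ xs) (suc a) zero ∎
  sum-quasi≈monomial (x ∷ xs) (suc a) (suc b) = begin
    sumOver (map (2 ∷_) V₂ ++ map (1 ∷_) V₁) (quasi (x ∷ xs))
      ≈⟨ sumOver-++ (map (2 ∷_) V₂) _ _ ⟩
    sumOver (map (2 ∷_) V₂) (quasi (x ∷ xs)) + sumOver (map (1 ∷_) V₁) (quasi (x ∷ xs))
      ≈⟨ +-cong (sum-map∷-quasi-∷ x xs 2 V₂) (sum-map∷-quasi-∷ x xs 1 V₁) ⟩
    (x ^ 2 * sumOver V₂ (quasi xs) + sumOver (map (2 ∷_) V₂) (quasi xs)) +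
    (x ^ 1 * sumOver V₁ (quasi xs) + sumOver (map (1 ∷_) V₁) (quasi xs))
      ≈⟨ solve 5 (λ x u u′ v v′ → (x :* (x :* con 1) :* u :+ u′) :+ (x :* con 1 :* v :+ v′)
                                    := (u′ :+ v′) :+ (x :* x :* u :+ x :* v)) ≈-refl x _ _ _ _ ⟩
    (sumOver (map (2 ∷_) V₂) (quasi xs) + sumOver (map (1 ∷_) V₁) (quasi xs)) +
    (x * x * sumOver V₂ (quasi xs) + x * sumOver V₁ (quasi xs))
      ≈⟨ +-cong (≈-trans (≈-sym (sumOver-++ (map (2 ∷_) V₂) _ _)) (sum-quasi≈monomial xs (suc a) (suc b)))
                (+-cong (*-congˡ (sum-quasi≈monomial xs a (suc b)))
                        (*-congˡ (sum-quasi≈monomial xs (suc a) b))) ⟩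
    monomial (x ∷ xs) (suc a) (suc b) ∎
    where
    V₂ = twoOneWords a (suc b)
    V₁ = twoOneWords (suc a) b

  -- Cancellation in the field

  #-cancelˡ : ∀ {x y u v} → x # y → (x - y) * u ≈ (x - y) * v → u ≈ v
  #-cancelˡ {x} {y} {u} {v} x#y eq = begin
    u                   ≈⟨ *-identityˡ u ⟨
    1# * u              ≈⟨ *-congʳ i*d≈1 ⟨
    (i * (x - y)) * u   ≈⟨ *-assoc _ _ _ ⟩
    i * ((x - y) * u)   ≈⟨ *-congˡ eq ⟩
    i * ((x - y) * v)   ≈⟨ *-assoc _ _ _ ⟨
    (i * (x - y)) * v   ≈⟨ *-congʳ i*d≈1 ⟩
    1# * v              ≈⟨ *-identityˡ v ⟩
    v                   ∎
    where
    i = inverseOfDifference x#y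
    i*d≈1 : i * (x - y) ≈ 1#
    i*d≈1 = proj₁ (proj₂ (#⇒invertible x#y))

  x-0≈x : ∀ x → x - 0# ≈ x
  x-0≈x x = ≈-trans (+-congˡ -0#≈0#) (+-identityʳ x)

  1+[x-1]≈x : ∀ x → 1# + (x - 1#) ≈ x
  1+[x-1]≈x x = begin
    1# + (x + - 1#)   ≈⟨ solve 2 (λ x m → con 1 :+ (x :+ m) := x :+ (con 1 :+ m)) ≈-refl x (- 1#) ⟩
    x + (1# + - 1#)   ≈⟨ +-congˡ (-‿inverseʳ 1#) ⟩
    x + 0#            ≈⟨ +-identityʳ x ⟩
    x                 ∎

  ∏[1+xs*s]≈0 : ∀ {x} xs s → x ∈ xs → 1# + x * s ≈ 0# → ∏[1+ xs *s] s ≈ 0#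
  ∏[1+xs*s]≈0 (x ∷ xs) s (here ≡.refl) eq = ≈-trans (*-congʳ eq) (zeroˡ _)
  ∏[1+xs*s]≈0 (y ∷ xs) s (there x∈xs)  eq = ≈-trans (*-congˡ (∏[1+xs*s]≈0 xs s x∈xs eq)) (zeroʳ _)

  -- Evaluation at the points ζⁱ - 1

  module _ (N : ℕ) {ζ : Carrier} (prim : IsPrimitiveRoot (suc N) ζ) where

    open IsPrimitiveRoot prim

    xs : List Carrier
    xs = map ([1-ζ^_]⁻¹ (suc N) prim) (allFin N)

    length-xs : length xs ≡ N
    length-xs = ≡.trans (length-map _ (allFin N)) (length-tabulate {n = N} (λ i → i))

    𝒴≈monomial : ∀ a b → 𝒴 (suc N) prim (replicate a 2 ++ replicate b 1) ≈ monomial xs a b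
    𝒴≈monomial a b = begin
      sumOver (distinctRearrangements (replicate a 2 ++ replicate b 1)) (ℨ (suc N) prim)
        ≈⟨ sumOver-↭ _ (distinctRearrangements↭twoOneWords a b) ⟩
      sumOver (twoOneWords a b) (ℨ (suc N) prim)
        ≈⟨ sumOver-cong (twoOneWords a b) (sum-choose≈quasi ([1-ζ^_]⁻¹ (suc N) prim) (allFin N)) ⟩
      sumOver (twoOneWords a b) (quasi xs)
        ≈⟨ sum-quasi≈monomial xs a b ⟩
      monomial xs a b ∎

    root : ℕ → Carrier
    root i = ζ ^ i - 1#

    1+root : ∀ i → 1# + root i ≈ ζ ^ i
    1+root i = 1+[x-1]≈x (ζ ^ i)

    -- Primitivity only separates 1 from powers of ζ. With d = j - i and e = n - i, multiplication
    -- by ζᵉ = ζ⁻ⁱ turns ζʲ y = ζⁱ y into ζᵈ y = y, and 1 - ζᵈ is invertible because 0 < d < n.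
    root-cancel : ∀ i j → i ℕ.< j → j ℕ.< suc N → ∀ y → (root j - root i) * y ≈ 0# → y ≈ 0#
    root-cancel i j i<j j<n y eq with d , ≡.refl ← ℕ.m≤n⇒∃[o]m+o≡n (ℕ.<⇒≤ i<j)
                                    | e , i+e≡n ← ℕ.m≤n⇒∃[o]m+o≡n (ℕ.<⇒≤ (ℕ.<-trans i<j j<n)) =
      #-cancelˡ (1#ζ^i d 0<d (ℕ.≤-<-trans (ℕ.m≤n+m d i) j<n)) (begin
        (1# - ζ ^ d) * y     ≈⟨ [y-z]x≈yx-zx y 1# (ζ ^ d) ⟩
        1# * y - ζ ^ d * y   ≈⟨ x≈y⇒x∙y⁻¹≈ε (≈-trans (*-identityˡ y) y≈ζᵈy) ⟩
        0#                   ≈⟨ zeroʳ _ ⟨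
        (1# - ζ ^ d) * 0#    ∎)
      where
      0<d : 0 ℕ.< d
      0<d = ℕ.+-cancelˡ-< i 0 d (≡.subst (ℕ._< i ℕ.+ d) (≡.sym (ℕ.+-identityʳ i)) i<j)
      ζʲy≈ζⁱy : ζ ^ (i ℕ.+ d) * y ≈ ζ ^ i * y
      ζʲy≈ζⁱy = begin
        ζ ^ (i ℕ.+ d) * y             ≈⟨ *-congʳ (1+root (i ℕ.+ d)) ⟨
        (1# + root (i ℕ.+ d)) * y     ≈⟨ distribʳ y 1# _ ⟩
        1# * y + root (i ℕ.+ d) * y   ≈⟨ +-congˡ (x∙y⁻¹≈ε⇒x≈y _ _ (≈-trans (≈-sym ([y-z]x≈yx-zx y _ _)) eq)) ⟩
        1# * y + root i * y           ≈⟨ distribʳ y 1# _ ⟨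
        (1# + root i) * y             ≈⟨ *-congʳ (1+root i) ⟩
        ζ ^ i * y                     ∎
      ζᵉζⁱ≈1 : ζ ^ e * ζ ^ i ≈ 1#
      ζᵉζⁱ≈1 = begin
        ζ ^ e * ζ ^ i   ≈⟨ *-comm _ _ ⟩
        ζ ^ i * ζ ^ e   ≈⟨ ^-homo-* ζ i e ⟨
        ζ ^ (i ℕ.+ e)   ≡⟨ ≡.cong (ζ ^_) i+e≡n ⟩
        ζ ^ suc N       ≈⟨ ζ^n≈1 ⟩
        1#              ∎
      y≈ζᵈy : y ≈ ζ ^ d * y
      y≈ζᵈy = begin
        y                             ≈⟨ *-identityˡ y ⟨
        1# * y                        ≈⟨ *-congʳ ζᵉζⁱ≈1 ⟨
        ζ ^ e * ζ ^ i * y             ≈⟨ *-assoc _ _ _ ⟩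
        ζ ^ e * (ζ ^ i * y)           ≈⟨ *-congˡ ζʲy≈ζⁱy ⟨
        ζ ^ e * (ζ ^ (i ℕ.+ d) * y)   ≈⟨ *-congˡ (*-congʳ (^-homo-* ζ i d)) ⟩
        ζ ^ e * (ζ ^ i * ζ ^ d * y)   ≈⟨ solve 4 (λ a b c y → a :* (b :* c :* y) := a :* b :* (c :* y))
                                           ≈-refl (ζ ^ e) (ζ ^ i) (ζ ^ d) y ⟩
        ζ ^ e * ζ ^ i * (ζ ^ d * y)   ≈⟨ *-congʳ ζᵉζⁱ≈1 ⟩
        1# * (ζ ^ d * y)              ≈⟨ *-identityˡ _ ⟩
        ζ ^ d * y                     ∎

    -- The point ζⁱ - 1 is -1/xᵢ, the zero of the factor 1 + xᵢ s.
    1+inverse*root≈0 : ∀ k → 1# + [1-ζ^_]⁻¹ (suc N) prim k * root (suc (toℕ k)) ≈ 0#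
    1+inverse*root≈0 k = begin
      1# + x * (z - 1#)        ≈⟨ +-congʳ (proj₁ (proj₂ (#⇒invertible 1#z))) ⟨
      x * (1# - z) + x * (z - 1#)
        ≈⟨ solve 4 (λ x z z⁻ 1⁻ → x :* (con 1 :+ z⁻) :+ x :* (z :+ 1⁻)
                                    := x :* ((con 1 :+ 1⁻) :+ (z :+ z⁻))) ≈-refl x z (- z) (- 1#) ⟩
      x * ((1# - 1#) + (z - z)) ≈⟨ *-congˡ (+-cong (-‿inverseʳ 1#) (-‿inverseʳ z)) ⟩
      x * (0# + 0#)             ≈⟨ solve 1 (λ x → x :* (con 0 :+ con 0) := con 0) ≈-refl x ⟩
      0#                        ∎
      where
      x = [1-ζ^_]⁻¹ (suc N) prim k
      z = ζ ^ suc (toℕ k)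
      1#z = 1#ζ^i (suc (toℕ k)) (s≤s z≤n) (ℕ.m≤pred[n]⇒suc[m]≤n (toℕ<n k))

    eval-elementary-root : ∀ k → eval (elementary xs) (suc N) (root (suc (toℕ k))) ≈ 0#
    eval-elementary-root k = ≈-trans
      (eval-elementary xs N _ (ℕ.≤-reflexive length-xs))
      (∏[1+xs*s]≈0 xs _ (∈-map⁺ _ (∈-allFin k)) (1+inverse*root≈0 k))

    ζ^i^n≈1 : ∀ i → (ζ ^ i) ^ suc N ≈ 1#
    ζ^i^n≈1 i = begin
      (ζ ^ i) ^ suc N      ≈⟨ ^-assocʳ ζ i (suc N) ⟩
      ζ ^ (i ℕ.* suc N)    ≡⟨ ≡.cong (ζ ^_) (ℕ.*-comm i (suc N)) ⟩
      ζ ^ (suc N ℕ.* i)    ≈⟨ ^-assocʳ ζ (suc N) i ⟨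
      (ζ ^ suc N) ^ i      ≈⟨ ^-congˡ i ζ^n≈1 ⟩
      1# ^ i               ≈⟨ 1^ i ⟩
      1#                   ∎
      where
      1^ : ∀ i → 1# ^ i ≈ 1#
      1^ zero    = ≈-refl
      1^ (suc i) = ≈-trans (*-identityˡ _) (1^ i)

    -- The coefficients are those of ((1 + s)ⁿ - 1) / s.
    eval-binomial-root : ∀ i → 0 ℕ.< i → i ℕ.< suc N →
      eval (λ k → fromℕ (suc N C suc k)) (suc N) (root i) ≈ 0#
    eval-binomial-root i 0<i i<n = #-cancelˡ (1#ζ^i i 0<i i<n) (begin
      (1# - z) * y             ≈⟨ +-identityˡ _ ⟨
      0# + (1# - z) * y        ≈⟨ +-congʳ sy≈0 ⟨
      (z - 1#) * y + (1# - z) * y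
        ≈⟨ solve 4 (λ y z z⁻ 1⁻ → (z :+ 1⁻) :* y :+ (con 1 :+ z⁻) :* y
                                    := ((con 1 :+ 1⁻) :+ (z :+ z⁻)) :* y) ≈-refl y z (- z) (- 1#) ⟩
      ((1# - 1#) + (z - z)) * y  ≈⟨ *-congʳ (+-cong (-‿inverseʳ 1#) (-‿inverseʳ z)) ⟩
      (0# + 0#) * y              ≈⟨ solve 1 (λ y → (con 0 :+ con 0) :* y := con 0) ≈-refl y ⟩
      0#                         ≈⟨ zeroʳ _ ⟨
      (1# - z) * 0#              ∎)
      where
      z = ζ ^ i
      y = eval (λ k → fromℕ (suc N C suc k)) (suc N) (root i)
      1+sy≈1 : 1# + (z - 1#) * y ≈ 1# + 0#
      1+sy≈1 = begin
        1# + (z - 1#) * y          ≈⟨ +-congʳ (×-homo-1 1#) ⟨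
        -- By the definition of `eval`, the expansion of (1 + s)ⁿ is its constant term 1 plus s
        -- times y.
        1 · 1# + (z - 1#) * y      ≈⟨ binomial-theorem (suc N) (root i) ⟩
        (1# + root i) ^ suc N      ≈⟨ ^-congˡ (suc N) (1+root i) ⟩
        z ^ suc N                  ≈⟨ ζ^i^n≈1 i ⟩
        1#                         ≈⟨ +-identityʳ 1# ⟨
        1# + 0#                    ∎
      sy≈0 : (z - 1#) * y ≈ 0#
      sy≈0 = +-cancelˡ 1# _ _ 1+sy≈1

    n*elementary : ∀ k → k ℕ.< suc N →
      fromℕ (suc N) * elementary xs k ≈ fromℕ (suc N C suc k)
    n*elementary = coefficients-unique (suc N) _ _ root root-cancel agree
      where
      f : ℕ → Carrier
      f k = fromℕ (suc N) * elementary xs k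
      g : ℕ → Carrier
      g k = fromℕ (suc N C suc k)
      agree : ∀ i → i ℕ.< suc N → eval f (suc N) (root i) ≈ eval g (suc N) (root i)
      agree zero    _ = begin
        eval f (suc N) (root 0)              ≈⟨ eval-root₀ f ⟩
        fromℕ (suc N) * elementary xs 0      ≈⟨ *-congˡ (elementary-0 xs) ⟩
        fromℕ (suc N) * 1#                   ≈⟨ *-identityʳ _ ⟩
        fromℕ (suc N)                        ≡⟨ ≡.cong fromℕ (nC1≡n (suc N)) ⟨
        g 0                                  ≈⟨ eval-root₀ g ⟨
        eval g (suc N) (root 0)              ∎
        where
        eval-root₀ : ∀ h → eval h (suc N) (root 0) ≈ h 0
        eval-root₀ h = ≈-trans (+-congˡ (≈-trans (*-congʳ (-‿inverseʳ 1#)) (zeroˡ _))) (+-identityʳ _)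
      agree (suc i) (s≤s i<N) = begin
        eval f (suc N) (root (suc i))
          ≈⟨ eval-*ˡ (elementary xs) (fromℕ (suc N)) (suc N) _ ⟩
        fromℕ (suc N) * eval (elementary xs) (suc N) (root (suc i))
          ≡⟨ ≡.cong (λ j → fromℕ (suc N) * eval (elementary xs) (suc N) (root (suc j))) (toℕ-fromℕ< i<N) ⟨
        fromℕ (suc N) * eval (elementary xs) (suc N) (root (suc (toℕ (fromℕ< i<N))))
          ≈⟨ *-congˡ (eval-elementary-root (fromℕ< i<N)) ⟩
        fromℕ (suc N) * 0#
          ≈⟨ zeroʳ _ ⟩
        0#
          ≈⟨ eval-binomial-root (suc i) (s≤s z≤n) (s≤s i<N) ⟨
        eval g (suc N) (root (suc i)) ∎

    -- Closed form of the elementary symmetric polynomials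

    module _ (char0 : CharacteristicZero) where

      fromℕ-cancelˡ : ∀ k .{{_ : NonZero k}} {u v} → fromℕ k * u ≈ fromℕ k * v → u ≈ v
      fromℕ-cancelˡ k eq = #-cancelˡ (char0 k)
        (≈-trans (*-congʳ (x-0≈x _)) (≈-trans eq (≈-sym (*-congʳ (x-0≈x _)))))

      [k+1]*elementary : ∀ k → fromℕ (suc k) * elementary xs k ≈ fromℕ (N C k)
      [k+1]*elementary k with ℕ.<-≤-connex N k
      -- The coefficient comparison covers only k ≤ N. Beyond that both sides are 0, there being
      -- only N variables.
      ... | inj₁ N<k = begin
        fromℕ (suc k) * elementary xs k
          ≈⟨ *-congˡ (elementary-vanishes xs k (≡.subst (ℕ._< k) (≡.sym length-xs) N<k)) ⟩
        fromℕ (suc k) * 0#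
          ≈⟨ zeroʳ _ ⟩
        fromℕ 0
          ≡⟨ ≡.cong fromℕ (k>n⇒nCk≡0 N<k) ⟨
        fromℕ (N C k) ∎
      -- After multiplication by n, the absorption identity (k + 1) binom(n, k + 1) = n binom(n - 1,
      -- k) makes n cancel.
      ... | inj₂ k≤N = fromℕ-cancelˡ (suc N) (begin
        fromℕ (suc N) * (fromℕ (suc k) * elementary xs k)
          ≈⟨ solve 3 (λ a b c → a :* (b :* c) := b :* (a :* c)) ≈-refl _ _ _ ⟩
        fromℕ (suc k) * (fromℕ (suc N) * elementary xs k)
          ≈⟨ *-congˡ (n*elementary k (s≤s k≤N)) ⟩
        fromℕ (suc k) * fromℕ (suc N C suc k)
          ≈⟨ ×1-homo-* (suc k) (suc N C suc k) ⟨
        fromℕ (suc k ℕ.* (suc N C suc k))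
          ≡⟨ ≡.cong fromℕ ([k+1]*[n+1]C[k+1]≡[n+1]*nCk N k) ⟩
        fromℕ (suc N ℕ.* (N C k))
          ≈⟨ ×1-homo-* (suc N) (N C k) ⟩
        fromℕ (suc N) * fromℕ (N C k) ∎)

      elementary-product : ∀ m k →
        elementary xs m * elementary xs k
          ≈ reciprocal char0 (suc m ℕ.* suc k) * (fromℕ (N C m) * fromℕ (N C k))
      elementary-product m k = fromℕ-cancelˡ d (begin
        fromℕ d * (elementary xs m * elementary xs k)
          ≈⟨ *-congʳ (×1-homo-* (suc m) (suc k)) ⟩
        fromℕ (suc m) * fromℕ (suc k) * (elementary xs m * elementary xs k)
          ≈⟨ solve 4 (λ a b c d → a :* b :* (c :* d) := a :* c :* (b :* d)) ≈-refl _ _ _ _ ⟩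
        fromℕ (suc m) * elementary xs m * (fromℕ (suc k) * elementary xs k)
          ≈⟨ *-cong ([k+1]*elementary m) ([k+1]*elementary k) ⟩
        y
          ≈⟨ *-identityˡ _ ⟨
        1# * y
          ≈⟨ *-congʳ (proj₂ (proj₂ (#⇒invertible (char0 d)))) ⟨
        (fromℕ d - 0#) * reciprocal char0 d * y
          ≈⟨ *-congʳ (*-congʳ (x-0≈x _)) ⟩
        fromℕ d * reciprocal char0 d * y
          ≈⟨ *-assoc _ _ _ ⟩
        fromℕ d * (reciprocal char0 d * y) ∎)
        where
        d = suc m ℕ.* suc k
        y = fromℕ (N C m) * fromℕ (N C k)

    -- Matching the sum with the product expansion

    summand : ℕ → ℕ → ℕ → Carrier
    summand m ℓ j =
      fromℤ (binomial (+ m ℤ.- + ℓ ℤ.+ + (2 ℕ.* j)) j)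
        * 𝒴[2^_,1^_] (suc N) prim (+ ℓ ℤ.- + j) (+ m ℤ.- + ℓ ℤ.+ + (2 ℕ.* j))

    -- With p = ℓ - j and r = m - p natural numbers, both block lengths are nonnegative: p twos and
    -- r + j ones.
    summand≈productTerm : ∀ {m ℓ} p r j → m ≡ p ℕ.+ r → ℓ ≡ p ℕ.+ j →
                          summand m ℓ j ≈ productTerm xs p r j
    summand≈productTerm p r j ≡.refl ≡.refl
      rewrite p+j-j≡p (+ p) (+ j) | ones≡r+j (+ p) (+ r) (+ j) = begin
      fromℕ n * 𝒴 (suc N) prim (replicate p 2 ++ replicate (r ℕ.+ j) 1)
        ≈⟨ *-congˡ (𝒴≈monomial p (r ℕ.+ j)) ⟩
      fromℕ n * monomial xs p (r ℕ.+ j)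
        ≈⟨ ×-assoc-* n 1# _ ⟩
      n · (1# * monomial xs p (r ℕ.+ j))
        ≈⟨ ×-congʳ n (*-identityˡ _) ⟩
      n · monomial xs p (r ℕ.+ j) ∎
      where
      n = (r ℕ.+ j) C j

    -- m < p = ℓ - j: either the block of ones has negative length, or it is
    -- shorter than j and the binomial vanishes.
    summand≈0ˡ : ∀ {m ℓ} p j → ℓ ≡ p ℕ.+ j → m ℕ.< p → summand m ℓ j ≈ 0#
    summand≈0ˡ {m} p j ≡.refl m<p
      with d , ≡.refl ← ℕ.m≤n⇒∃[o]m+o≡n m<p
      with ℕ.<-≤-connex d j
    -- Here p = m + 1 + d, so there are j - d - 1 = e ones, and binom(e, j) = 0 since e < j.
    ... | inj₁ d<j with e , ≡.refl ← ℕ.m≤n⇒∃[o]m+o≡n d<j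
      rewrite p+j-j≡p (+ suc (m ℕ.+ d)) (+ suc (d ℕ.+ e)) | ones≡e (+ m) (+ d) (+ e)
      | k>n⇒nCk≡0 (s≤s (ℕ.m≤n+m e d)) = zeroˡ _
    -- The number of ones is -(1 + e). With this negative upper index `binomial` is not 0, so the
    -- zero must come from the `𝒴[2^_,1^_]` factor.
    ... | inj₂ j≤d with e , ≡.refl ← ℕ.m≤n⇒∃[o]m+o≡n j≤d
      rewrite p+j-j≡p (+ suc (m ℕ.+ (j ℕ.+ e))) (+ j) | ones≡-[1+e] (+ m) (+ j) (+ e) = zeroʳ _

    -- The block of twos has negative length.
    summand≈0ʳ : ∀ m ℓ j → ℓ ℕ.< j → summand m ℓ j ≈ 0#
    summand≈0ʳ m ℓ j ℓ<j with d , ≡.refl ← ℕ.m≤n⇒∃[o]m+o≡n ℓ<j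
      rewrite twos≡-[1+d] (+ ℓ) (+ d) = zeroʳ _

    -- When both blocks exist, the monomial has (ℓ - j) + (m - ℓ + 2j) = m + j distinct variables,
    -- and m + j ≥ n exceeds the N available. Truncated subtraction covers m ≥ n as well.
    summand-vanishes : ∀ m ℓ j → suc N ℕ.∸ m ℕ.≤ j → summand m ℓ j ≈ 0#
    summand-vanishes m ℓ j n∸m≤j with ℕ.<-≤-connex ℓ j
    ... | inj₁ ℓ<j = summand≈0ʳ m ℓ j ℓ<j
    ... | inj₂ j≤ℓ with ℕ.<-≤-connex m (ℓ ℕ.∸ j)
    ...   | inj₁ m<p = summand≈0ˡ (ℓ ℕ.∸ j) j (≡.sym (ℕ.m∸n+n≡m j≤ℓ)) m<p
    ...   | inj₂ p≤m = begin
      summand m ℓ j            ≈⟨ summand≈productTerm p r j (≡.sym p+r≡m) (≡.sym (ℕ.m∸n+n≡m j≤ℓ)) ⟩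
      productTerm xs p r j     ≈⟨ ×-congʳ ((r ℕ.+ j) C j) (monomial-vanishes xs p (r ℕ.+ j) N<) ⟩
      ((r ℕ.+ j) C j) · 0#     ≈⟨ n×0≈0 ((r ℕ.+ j) C j) ⟩
      0#                       ∎
      where
      p = ℓ ℕ.∸ j
      r = m ℕ.∸ p
      p+r≡m : p ℕ.+ r ≡ m
      p+r≡m = ℕ.m+[n∸m]≡n p≤m
      N< : length xs ℕ.< p ℕ.+ (r ℕ.+ j)
      N< = ≡.subst₂ ℕ._<_ (≡.sym length-xs)
             (≡.trans (≡.cong (ℕ._+ j) (≡.sym p+r≡m)) (ℕ.+-assoc p r j))
             (ℕ.≤-trans (ℕ.m≤n+m∸n (suc N) m) (ℕ.+-monoʳ-≤ m n∸m≤j))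

    -- The last summand j = k has p twos, and smaller j have more. Peeling off the last summand thus
    -- removes the first term of the tail and raises p by one.
    sum-summand≈productTail : ∀ {m ℓ} p q k → m ≡ p ℕ.+ q → ℓ ≡ p ℕ.+ k →
                              sumOver (upTo (suc k)) (summand m ℓ) ≈ productTail xs p q k
    sum-summand≈productTail {m} {ℓ} p q zero m≡ ℓ≡ = begin
      summand m ℓ 0 + 0#        ≈⟨ +-identityʳ _ ⟩
      summand m ℓ 0             ≈⟨ summand≈productTerm p q 0 m≡ ℓ≡ ⟩
      productTerm xs p q 0      ≡⟨ productTail-k≡0 xs p q ⟨
      productTail xs p q 0      ∎
    sum-summand≈productTail {m} {ℓ} p zero (suc k) m≡ ℓ≡ = begin
      sumOver (upTo (suc (suc k))) (summand m ℓ)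
        ≈⟨ sumOver-upTo-suc (suc k) (summand m ℓ) ⟩
      sumOver (upTo (suc k)) (summand m ℓ) + summand m ℓ (suc k)
        ≈⟨ +-cong (sumOver-upTo-zero (suc k) small) (summand≈productTerm p 0 (suc k) m≡ ℓ≡) ⟩
      0# + productTail xs p 0 (suc k)
        ≈⟨ +-identityˡ _ ⟩
      productTail xs p 0 (suc k) ∎
      where
      -- Here m = p, so every j below suc k would require ℓ - j > m squares.
      small : ∀ j → j ℕ.< suc k → summand m ℓ j ≈ 0#
      small j (s≤s j≤k) = summand≈0ˡ (ℓ ℕ.∸ j) j (≡.sym (ℕ.m∸n+n≡m (ℕ.<⇒≤ j<ℓ))) m<ℓ∸j
        where
        m+j<ℓ : m ℕ.+ j ℕ.< ℓ
        m+j<ℓ = ≡.subst₂ ℕ._<_ (≡.cong (ℕ._+ j) (≡.sym (≡.trans m≡ (ℕ.+-identityʳ p)))) (≡.sym ℓ≡)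
                  (ℕ.+-monoʳ-< p (s≤s j≤k))
        j<ℓ : j ℕ.< ℓ
        j<ℓ = ℕ.≤-<-trans (ℕ.m≤n+m j m) m+j<ℓ
        m<ℓ∸j : m ℕ.< ℓ ℕ.∸ j
        m<ℓ∸j = ℕ.m+n≤o⇒m≤o∸n (suc m) m+j<ℓ
    sum-summand≈productTail {m} {ℓ} p (suc q) (suc k) m≡ ℓ≡ = begin
      sumOver (upTo (suc (suc k))) (summand m ℓ)
        ≈⟨ sumOver-upTo-suc (suc k) (summand m ℓ) ⟩
      sumOver (upTo (suc k)) (summand m ℓ) + summand m ℓ (suc k)
        ≈⟨ +-cong (sum-summand≈productTail (suc p) q k (≡.trans m≡ (ℕ.+-suc p q)) (≡.trans ℓ≡ (ℕ.+-suc p k)))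
                  (summand≈productTerm p (suc q) (suc k) m≡ ℓ≡) ⟩
      productTail xs (suc p) q k + productTerm xs p (suc q) (suc k)
        ≈⟨ +-comm _ _ ⟩
      productTail xs p (suc q) (suc k) ∎

    sum-summand≈elementary-product : ∀ m ℓ →
      sumOver (upTo (suc N ℕ.∸ m)) (summand m ℓ) ≈ elementary xs m * elementary xs ℓ
    sum-summand≈elementary-product m ℓ = begin
      sumOver (upTo (suc N ℕ.∸ m)) (summand m ℓ)
        ≈⟨ sumOver-upTo-truncate (suc N ℕ.∸ m) (suc ℓ) (summand-vanishes m ℓ) (summand≈0ʳ m ℓ) ⟩
      sumOver (upTo (suc ℓ)) (summand m ℓ)
        ≈⟨ sum-summand≈productTail 0 m ℓ ≡.refl ≡.refl ⟩
      productTail xs 0 m ℓ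
        ≈⟨ elementary-*-elementary xs m ℓ ⟩
      elementary xs m * elementary xs ℓ ∎

theorem5 : ∀ {c ℓ₁ ℓ₂} (F : HeytingField c ℓ₁ ℓ₂) →
    let open HeytingField F
        open RootOfUnitySums F
    in (char0 : CharacteristicZero)
       (n m ℓ : ℕ) .{{_ : NonZero n}} .{{_ : NonZero m}} .{{_ : NonZero ℓ}}
       {ζ : Carrier} (prim : IsPrimitiveRoot n ζ) →
       (∑[ j ∈ upTo (n ℕ.∸ m) ]
          (fromℤ (binomial (+ m ℤ.- + ℓ ℤ.+ + (2 ℕ.* j)) j)
            * 𝒴[2^_,1^_] n prim (+ ℓ ℤ.- + j) (+ m ℤ.- + ℓ ℤ.+ + (2 ℕ.* j))))
       ≈ reciprocal char0 (suc m ℕ.* suc ℓ) * (fromℕ ((n ℕ.∸ 1) C m) * fromℕ ((n ℕ.∸ 1) C ℓ))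
theorem5 F char0 (suc N) m ℓ prim =
  HeytingField.trans F (sum-summand≈elementary-product N prim m ℓ) (elementary-product N prim char0 m ℓ)
  where open HeytingFieldSums F
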